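{- Let $n \geq 4$. Let $T_1$ be an $n$-leaf binary tree and $T_2$ an $n$-leaf left turn tree. Then $T_1$ and $T_2$ have a common parse word, i.e. there is a word of length $n$ on $\{0,1,2\}$ parsed by both $T_1$ and $T_2$.
   Context: A binary tree is a rooted ordered tree in which each vertex has either $0$ or $2$ children; its leaves are ordered left to right. Let $G$ be the context-free grammar with start symbols $0,1,2$ and rules $0\to 12$, $0\to 21$, $1\to 02$, $1\to 20$, $2\to 01$, $2\to 10$. An $n$-leaf binary tree $T$ parses a word $w$ of length $n$ on $\{0,1,2\}$ if there is a labeling of the vertices of $T$ by $0,1,2$ such that the leaves, from left to right, are labeled with the letters of $w$, and at every internal vertex the label of the vertex together with the labels of its left and right children form a rule of $G$ (i.e. the three labels are pairwise distinct). The level of a vertex is its distance from the root. A path tree is a binary tree with at most two vertices on each level. For $N\ge 2$, $N$-leaf path trees correspond bijectively to words $x_1\cdots x_{N-2}$ on $\{l,r\}$: $x_j=l$ (resp. $x_j=r$) means that, of the two vertices on level $j$, the left (resp. right) one has children. $\mathrm{LeftTurnTree}(p,q)$ is the $(p+q)$-leaf path tree corresponding to $l^p r^{q-2}$. An $n$-leaf left turn tree is a tree of the form $\mathrm{LeftTurnTree}(p,q)$ with $p+q=n$, where $p\ge 0$ and $q\ge 2$ are integers. -}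

module Defs where

open import Data.List.Base using (List; []; _∷_; _++_; replicate)
open import Data.Nat.Base using (ℕ; _+_; _∸_; _≤_)
open import Data.Product.Base using (Σ-syntax; ∃-syntax; _×_)
open import Data.Tree.Binary using (Tree; leaf; node; map; module Leaves)
open import Data.Unit.Base using (⊤; tt)
open import Relation.Binary.PropositionalEquality.Core using (_≡_)

data Symbol : Set where
  𝟎 𝟏 𝟐 : Symbol

Word : Set
Word = List Symbol

infix 4 _⟶_,_

data _⟶_,_ : Symbol → Symbol → Symbol → Set where
  𝟎⟶𝟏𝟐 : 𝟎 ⟶ 𝟏 , 𝟐
  𝟎⟶𝟐𝟏 : 𝟎 ⟶ 𝟐 , 𝟏
  𝟏⟶𝟎𝟐 : 𝟏 ⟶ 𝟎 , 𝟐
  𝟏⟶𝟐𝟎 : 𝟏 ⟶ 𝟐 , 𝟎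
  𝟐⟶𝟎𝟏 : 𝟐 ⟶ 𝟎 , 𝟏
  𝟐⟶𝟏𝟎 : 𝟐 ⟶ 𝟏 , 𝟎

BinaryTree : Set
BinaryTree = Tree ⊤ ⊤

LabelledTree : Set
LabelledTree = Tree Symbol Symbol

shape : LabelledTree → BinaryTree
shape = map (λ _ → tt) (λ _ → tt)

rootLabel : LabelledTree → Symbol
rootLabel (leaf a)     = a
rootLabel (node _ a _) = a

ObeysGrammar : LabelledTree → Set
ObeysGrammar (leaf _)     = ⊤
ObeysGrammar (node s a t) =
  (a ⟶ rootLabel s , rootLabel t) × ObeysGrammar s × ObeysGrammar t

-- A labelling of the vertices of T is a labelled tree of shape T; the root
-- may carry any of the three symbols, since all of them are start symbols.
infix 4 _parses_

_parses_ : BinaryTree → Word → Set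
T parses w =
  Σ[ L ∈ LabelledTree ] shape L ≡ T × Leaves.toList L ≡ w × ObeysGrammar L

data Side : Set where
  l r : Side

-- The path tree with N ≥ 2 leaves corresponding to a word of length N ∸ 2.
-- The head of the word says which of the two vertices on level 1 has
-- children; the subtree at that vertex is the path tree of the tail, its
-- level j being level j + 1 of the whole tree.
pathTree : List Side → BinaryTree
pathTree []       = node (leaf tt) tt (leaf tt)
pathTree (l ∷ xs) = node (pathTree xs) tt (leaf tt)
pathTree (r ∷ xs) = node (leaf tt) tt (pathTree xs)

-- Meaningful for q ≥ 2 only, where the subtraction is exact.
LeftTurnTree : ℕ → ℕ → BinaryTree
LeftTurnTree p q = pathTree (replicate p l ++ replicate (q ∸ 2) r)

IsLeftTurnTree : ℕ → BinaryTree → Set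
IsLeftTurnTree n T =
  ∃[ p ] ∃[ q ] 2 ≤ q × p + q ≡ n × T ≡ LeftTurnTree p q

{-# OPTIONS --safe #-}

-- Read the three symbols as the nonzero elements of the Klein four-group.  An
-- n-leaf tree is a triangulation of a polygon with vertices (the gaps between
-- leaves) 0, …, n, and a parse word is the sequence of differences along
-- 0, …, n of a proper 4-colouring of the triangulation.  LeftTurnTree p q
-- joins vertex q to 0, …, q - 1 and vertex 0 to q, …, n.  So, giving 0 and q
-- the colours 0 and 3, we need a proper colouring of T₁ in which vertices left
-- of q avoid 3 and vertices right of q avoid 0.
--
-- If vertex 0 is not joined to q in T₁, the triangles separating 0 from q form
-- a strip.  Colour it with {1, 2, x}, where x means 0 to the left of q and 3
-- to the right.  Such a colouring is unique up to renaming the classes, so the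
-- only choice is which of the three classes is x.  In the strip, the right
-- neighbour of q must not have colour 3, and the left neighbour of 0 must not
-- have colour 0: each excludes one choice.  All other parts of T₁ lie on one
-- side of q and need only three colours.
module Submission where

open import Defs
open import Data.Bool.Properties using (T?)
open import Data.Fin.Base using (Fin)
open import Data.Fin.Patterns
open import Data.Fin.Properties using (_≟_; all?; any?)
open import Data.List.Base using (length; []; _∷_; _++_; replicate; [_])
open import Data.List.Properties using (++-assoc; ++-identityʳ; length-++)
open import Data.Nat.Base
  using (ℕ; zero; suc; _+_; _≤_; s≤s; compare; less; equal; greater)
open import Data.Nat.Properties
  using (+-assoc; +-comm; +-suc; +-cancelˡ-≡; suc-injective)
open import Data.Product.Base using (∃-syntax; Σ-syntax; _×_; _,_)
open import Data.Tree.Binary using (#leaves; leaf; node; module Leaves)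
open import Data.Unit.Base using (tt)
open import Function.Base using (_∘_)
open import Relation.Binary.PropositionalEquality.Core
  using (_≡_; _≢_; refl; sym; trans; cong; cong₂; subst; subst₂; ≢-sym)
open import Relation.Nullary.Negation.Core using (contradiction)
open import Relation.Nullary.Decidable
  using (Dec; False; toWitnessFalse; fromWitnessFalse; from-yes; _×-dec_)

private variable
  i j : ℕ
  v w : Word
  s t : BinaryTree

-- Parse derivations.

infix 4 _⊢_⇒_

data _⊢_⇒_ : BinaryTree → Symbol → Word → Set where
  leaf : ∀ {a} → leaf tt ⊢ a ⇒ [ a ]
  node : ∀ {a b c} → a ⟶ b , c → s ⊢ b ⇒ v → t ⊢ c ⇒ w →
         node s tt t ⊢ a ⇒ v ++ w

length-⇒ : ∀ {a} → t ⊢ a ⇒ w → length w ≡ #leaves t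
length-⇒ leaf = refl
length-⇒ (node {v = v} _ Ds Dt) =
  trans (length-++ v) (cong₂ _+_ (length-⇒ Ds) (length-⇒ Dt))

⇒-labelling : ∀ {a} → t ⊢ a ⇒ w →
  Σ[ L ∈ LabelledTree ] shape L ≡ t × (∀ k → Leaves.toDiffList L k ≡ w ++ k) ×
                        ObeysGrammar L × rootLabel L ≡ a
⇒-labelling (leaf {a}) = leaf a , refl , (λ _ → refl) , tt , refl
⇒-labelling (node {v = v} {w = w} {a = a} rule Ds Dt)
  with S , refl , leavesS , obeysS , refl ← ⇒-labelling Ds
     | T , refl , leavesT , obeysT , refl ← ⇒-labelling Dt =
  node S a T , refl ,
  (λ k → trans (leavesS _) (trans (cong (v ++_) (leavesT k)) (sym (++-assoc v w k)))) ,
  (rule , obeysS , obeysT) , refl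

⇒-parses : ∀ {a} → t ⊢ a ⇒ w → t parses w
⇒-parses {w = w} D with L , shape≡ , leaves≡ , obeys , _ ← ⇒-labelling D =
  L , shape≡ , trans (leaves≡ []) (++-identityʳ w) , obeys

-- Polygon colourings.

Colour : Set
Colour = Fin 4

private variable
  a b c d : Colour

infix 4 _≉_

-- Computes to ⊤ or ⊥ on closed colours, so that Agda fills in such proofs.
_≉_ : Colour → Colour → Set
a ≉ b = False (a ≟ b)

_≉?_ : (a b : Colour) → Dec (a ≉ b)
_ ≉? _ = T? _

≉-sym : a ≉ b → b ≉ a
≉-sym = fromWitnessFalse ∘ ≢-sym ∘ toWitnessFalse

other : ∀ a b d → ∃[ c ] (a ≉ c × c ≉ b × c ≉ d)
other = from-yes (all? λ a → all? λ b → all? λ d → any? λ c →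
                  a ≉? c ×-dec c ≉? b ×-dec c ≉? d)

infixl 6 _⊕_

-- The value on the diagonal is junk.
_⊕_ : Colour → Colour → Symbol
0F ⊕ 1F = 𝟎
0F ⊕ 2F = 𝟏
0F ⊕ 3F = 𝟐
1F ⊕ 0F = 𝟎
1F ⊕ 2F = 𝟐
1F ⊕ 3F = 𝟏
2F ⊕ 0F = 𝟏
2F ⊕ 1F = 𝟐
2F ⊕ 3F = 𝟎
3F ⊕ 0F = 𝟐
3F ⊕ 1F = 𝟏
3F ⊕ 2F = 𝟎
_  ⊕ _  = 𝟎

-- In the Klein four-group the differences around a properly coloured triangle are nonzero and sum
-- to zero, hence distinct.
⊕-rule : ∀ a b c → a ≉ b → a ≉ c → c ≉ b → a ⊕ b ⟶ a ⊕ c , c ⊕ b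
⊕-rule 3F 3F _  () _  _
⊕-rule 3F _  3F _  () _
⊕-rule _  3F 3F _  _  ()
⊕-rule 2F 3F 2F _  () _
⊕-rule 0F 1F 2F _ _ _ = 𝟎⟶𝟏𝟐
⊕-rule 0F 1F 3F _ _ _ = 𝟎⟶𝟐𝟏
⊕-rule 0F 2F 1F _ _ _ = 𝟏⟶𝟎𝟐
⊕-rule 0F 2F 3F _ _ _ = 𝟏⟶𝟐𝟎
⊕-rule 0F 3F 1F _ _ _ = 𝟐⟶𝟎𝟏
⊕-rule 0F 3F 2F _ _ _ = 𝟐⟶𝟏𝟎
⊕-rule 1F 0F 2F _ _ _ = 𝟎⟶𝟐𝟏
⊕-rule 1F 0F 3F _ _ _ = 𝟎⟶𝟏𝟐
⊕-rule 1F 2F 0F _ _ _ = 𝟐⟶𝟎𝟏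
⊕-rule 1F 2F 3F _ _ _ = 𝟐⟶𝟏𝟎
⊕-rule 1F 3F 0F _ _ _ = 𝟏⟶𝟎𝟐
⊕-rule 1F 3F 2F _ _ _ = 𝟏⟶𝟐𝟎
⊕-rule 2F 0F 1F _ _ _ = 𝟏⟶𝟐𝟎
⊕-rule 2F 0F 3F _ _ _ = 𝟏⟶𝟎𝟐
⊕-rule 2F 1F 0F _ _ _ = 𝟐⟶𝟏𝟎
⊕-rule 2F 1F 3F _ _ _ = 𝟐⟶𝟎𝟏
⊕-rule 2F 3F 0F _ _ _ = 𝟎⟶𝟏𝟐
⊕-rule 2F 3F 1F _ _ _ = 𝟎⟶𝟐𝟏
⊕-rule 3F 0F 1F _ _ _ = 𝟐⟶𝟏𝟎
⊕-rule 3F 0F 2F _ _ _ = 𝟐⟶𝟎𝟏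
⊕-rule 3F 1F 0F _ _ _ = 𝟏⟶𝟐𝟎
⊕-rule 3F 1F 2F _ _ _ = 𝟏⟶𝟎𝟐
⊕-rule 3F 2F 0F _ _ _ = 𝟎⟶𝟐𝟏
⊕-rule 3F 2F 1F _ _ _ = 𝟎⟶𝟏𝟐

-- Only the interior colours have to avoid d.
data Walk (d : Colour) : Colour → Word → Colour → Set where
  edge : a ≉ b → Walk d a [ a ⊕ b ] b
  step : a ≉ c → c ≉ d → Walk d c w b → Walk d a (a ⊕ c ∷ w) b

join : Walk d a v c → c ≉ d → Walk d c w b → Walk d a (v ++ w) b
join (edge a≉c)       c≉d q = step a≉c c≉d q
join (step a≉e e≉d p) c≉d q = step a≉e e≉d (join p c≉d q)

Filling : BinaryTree → Colour → Colour → Colour → Set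
Filling t d a b = ∃[ w ] (t ⊢ a ⊕ b ⇒ w × Walk d a w b)

fill : ∀ t → a ≉ b → a ≉ d → b ≉ d → Filling t d a b
fill             (leaf tt)     a≉b _ _ = _ , leaf , edge a≉b
fill {a} {b} {d} (node s tt t) a≉b a≉d b≉d
  with c , a≉c , c≉b , c≉d ← other a b d
  with _ , Ds , p ← fill s a≉c a≉d c≉d
     | _ , Dt , q ← fill t c≉b c≉d b≉d =
  _ , node (⊕-rule a b c a≉b a≉c c≉b) Ds Dt , join p c≉d q

-- Triangles at the right end are peeled off one by one; the pieces left over avoid `d` altogether
-- and go to `fill`.
fan : ∀ t → a ≉ d → Filling t d a d
fan         (leaf tt)     a≉d = _ , leaf , edge a≉d
fan {a} {d} (node s tt t) a≉d
  with c , a≉c , c≉d , _ ← other a d d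
  with _ , Ds , p ← fill s a≉c a≉d c≉d
     | _ , Dt , q ← fan t c≉d =
  _ , node (⊕-rule a d c a≉d a≉c c≉d) Ds Dt , join p c≉d q

-- Cutting at the second hub.

-- A gap with i ≥ 1 leaves to its left and j ≥ 1 to its right.
data Gap : BinaryTree → ℕ → ℕ → Set where
  here : Gap (node s tt t) (#leaves s) (#leaves t)
  inˡ  : Gap s i j → Gap (node s tt t) i (j + #leaves t)
  inʳ  : Gap t i j → Gap (node s tt t) (#leaves s + i) j

gap : ∀ t i j → suc i + suc j ≡ #leaves t → Gap t (suc i) (suc j)
gap (leaf tt) i j eq with () ← trans (sym (+-suc i j)) (suc-injective eq)
gap (node s tt t) i j eq with #leaves s in #s | compare (suc i) (#leaves s)
... | _ | less _ k =
  subst (Gap _ _) (sym (+-cancelˡ-≡ (suc i) _ _ eq′)) (inˡ (gap s i k #s′))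
  where
  #s′ = trans (+-suc (suc i) k) (sym #s)
  eq′ = trans eq (trans (cong (_+ #leaves t) (sym (+-suc (suc i) k)))
                        (+-assoc (suc i) (suc k) (#leaves t)))
... | _ | equal _ = subst₂ (Gap _) #s (sym (+-cancelˡ-≡ (suc i) _ _ eq)) here
... | _ | greater _ k =
  subst (λ m → Gap (node s tt t) m (suc j)) (trans (cong (_+ suc k) #s) (+-suc _ k))
  (inʳ {s = s} (gap t k j (+-cancelˡ-≡ _ _ _ (trans eq′ eq))))
  where
  eq′ = trans (sym (+-assoc _ (suc k) (suc j))) (cong (_+ suc j) (+-suc _ k))

-- If a is the colour 0 of the hub at vertex 0, then v ++ w is also parsed by
-- the left turn tree whose other hub, of colour 3, lies between v and w.
Cut : BinaryTree → ℕ → ℕ → Colour → Colour → Set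
Cut t i j a b = ∃[ v ] ∃[ w ] (length v ≡ i × length w ≡ j ×
  t ⊢ a ⊕ b ⇒ v ++ w × Walk 3F a v 3F × Walk 0F 3F w b)

cut-here : a ≉ 3F → 3F ≉ b → b ≉ 0F → a ≉ b →
           Cut (node s tt t) (#leaves s) (#leaves t) a b
cut-here {a} {b} {s} {t} a≉3 3≉b b≉0 a≉b
  with v , Ds , p ← fan s a≉3
     | w , Dt , q ← fill t 3≉b _ b≉0 =
  v , w , length-⇒ Ds , length-⇒ Dt ,
  node (⊕-rule a b 3F a≉b a≉3 3≉b) Ds Dt , p , q

extendʳ : a ≉ b → a ≉ c → c ≉ b → c ≉ 0F → b ≉ 0F →
          Cut s i j a c → Cut (node s tt t) i (j + #leaves t) a b
extendʳ {a} {b} {c} {t = t} a≉b a≉c c≉b c≉0 b≉0 (v , w , refl , refl , Ds , p , q)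
  with z , Dt , q′ ← fill t c≉b c≉0 b≉0 =
  v , w ++ z , refl , trans (length-++ w) (cong (length w +_) (length-⇒ Dt)) ,
  subst (_ ⊢ _ ⇒_) (++-assoc v w z) (node (⊕-rule a b c a≉b a≉c c≉b) Ds Dt) ,
  p , join q c≉0 q′

extendˡ : a ≉ b → a ≉ c → c ≉ b → a ≉ 3F → c ≉ 3F →
          Cut t i j c b → Cut (node s tt t) (#leaves s + i) j a b
extendˡ {a} {b} {c} {s = s} a≉b a≉c c≉b a≉3 c≉3 (v , w , refl , refl , Dt , p , q)
  with u , Ds , p′ ← fill s a≉c a≉3 c≉3 =
  u ++ v , w , trans (length-++ u) (cong (_+ length v) (length-⇒ Ds)) , refl ,
  subst (_ ⊢ _ ⇒_) (sym (++-assoc u v w)) (node (⊕-rule a b c a≉b a≉c c≉b) Ds Dt) ,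
  join p′ c≉3 p , q

-- Where the class x = 0/3 of a strip colouring sits: at the left end, at the
-- right end, or at the apex opposite to the edge between the ends.
data Place : Set where
  left right apex : Place

data Ends : Place → Colour → Colour → Set where
  l₁ : Ends left  0F 1F
  l₂ : Ends left  0F 2F
  r₁ : Ends right 1F 3F
  r₂ : Ends right 2F 3F
  a₁ : Ends apex  1F 2F
  a₂ : Ends apex  2F 1F

CutAt : Place → BinaryTree → ℕ → ℕ → Set
CutAt x t i j = ∀ {a b} → Ends x a b → Cut t i j a b

-- Descending to the left child makes the apex the new right end, so these two classes swap; `moveˡ`
-- is the mirror image.
moveʳ moveˡ : Place → Place
moveʳ left  = left
moveʳ right = apex
moveʳ apex  = right
moveˡ left  = apex
moveˡ right = right
moveˡ apex  = left

moveʳ-involutive : ∀ x → moveʳ (moveʳ x) ≡ x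
moveʳ-involutive left  = refl
moveʳ-involutive right = refl
moveʳ-involutive apex  = refl

moveˡ-involutive : ∀ x → moveˡ (moveˡ x) ≡ x
moveˡ-involutive left  = refl
moveˡ-involutive right = refl
moveˡ-involutive apex  = refl

cutAt-inˡ : ∀ x → CutAt (moveʳ x) s i j →
            CutAt x (node s tt t) i (j + #leaves t)
cutAt-inˡ _ cut l₁ = extendʳ _ _ _ _ _ (cut l₂)
cutAt-inˡ _ cut l₂ = extendʳ _ _ _ _ _ (cut l₁)
cutAt-inˡ _ cut r₁ = extendʳ _ _ _ _ _ (cut a₁)
cutAt-inˡ _ cut r₂ = extendʳ _ _ _ _ _ (cut a₂)
cutAt-inˡ _ cut a₁ = extendʳ _ _ _ _ _ (cut r₁)
cutAt-inˡ _ cut a₂ = extendʳ _ _ _ _ _ (cut r₂)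

cutAt-inʳ : ∀ x → CutAt (moveˡ x) t i j →
            CutAt x (node s tt t) (#leaves s + i) j
cutAt-inʳ _ cut l₁ = extendˡ _ _ _ _ _ (cut a₂)
cutAt-inʳ _ cut l₂ = extendˡ _ _ _ _ _ (cut a₁)
cutAt-inʳ _ cut r₁ = extendˡ _ _ _ _ _ (cut r₂)
cutAt-inʳ _ cut r₂ = extendˡ _ _ _ _ _ (cut r₁)
cutAt-inʳ _ cut a₁ = extendˡ _ _ _ _ _ (cut l₂)
cutAt-inʳ _ cut a₂ = extendˡ _ _ _ _ _ (cut l₁)

-- The bad place is the one which, at the triangle of the gap, would give
-- colour 3 to a neighbour of the hub.
strip : Gap t i j → ∃[ bad ] (∀ x → x ≢ bad → CutAt x t i j)
strip here = right , λ where
  left  _   l₁ → cut-here _ _ _ _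
  left  _   l₂ → cut-here _ _ _ _
  right r≢r    → contradiction refl r≢r
  apex  _   a₁ → cut-here _ _ _ _
  apex  _   a₂ → cut-here _ _ _ _
strip (inˡ g) with bad , cut ← strip g =
  moveʳ bad , λ x x≢ → cutAt-inˡ x
    (cut (moveʳ x) λ { refl → x≢ (sym (moveʳ-involutive x)) })
strip (inʳ g) with bad , cut ← strip g =
  moveˡ bad , λ x x≢ → cutAt-inʳ x
    (cut (moveˡ x) λ { refl → x≢ (sym (moveˡ-involutive x)) })

cut : Gap t i j → ∃[ b ] (b ≉ 0F × Cut t i j 0F b)
cut here    = 1F , _ , cut-here _ _ _ _
cut (inˡ g) with c , c≉0 , K ← cut g
  with b , c≉b , b≉0 , _ ← other c 0F 0F =
  b , b≉0 , extendʳ (≉-sym b≉0) (≉-sym c≉0) c≉b c≉0 b≉0 K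
cut (inʳ g) with strip g
-- Here the strip starts. Place `left` would give its left end the colour 0 of vertex 0; of `apex`
-- and `right`, at least one is not bad.
... | left  , K = 2F , _ , extendˡ _ _ _ _ _ (K apex  (λ ()) a₁)
... | right , K = 2F , _ , extendˡ _ _ _ _ _ (K apex  (λ ()) a₁)
... | apex  , K = 3F , _ , extendˡ _ _ _ _ _ (K right (λ ()) r₁)

-- Parsing by the left turn tree.

replicate-shift : ∀ {A : Set} n (x : A) xs →
                  replicate n x ++ x ∷ xs ≡ x ∷ replicate n x ++ xs
replicate-shift zero    x xs = refl
replicate-shift (suc n) x xs = cong (x ∷_) (replicate-shift n x xs)

rightComb-⇒ : ∀ k → a ≉ d → length w ≡ 2 + k → Walk d a w d →
              pathTree (replicate k r) ⊢ a ⊕ d ⇒ w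
rightComb-⇒ {a} {d} zero a≉d _ (step {c = c} a≉c c≉d (edge _)) =
  node (⊕-rule a d c a≉d a≉c c≉d) leaf leaf
rightComb-⇒ zero _ () (step _ _ (step _ _ (edge _)))
rightComb-⇒ zero _ () (step _ _ (step _ _ (step _ _ _)))
rightComb-⇒ {a} {d} (suc k) a≉d len (step {c = c} a≉c c≉d p) =
  node (⊕-rule a d c a≉d a≉c c≉d) leaf (rightComb-⇒ k c≉d (suc-injective len) p)

-- The hub is the left end. Each edge of the walk puts a new root above the tree built so far, whose
-- path word is `xs`.
leftSpine-⇒ : ∀ xs → d ≉ c → pathTree xs ⊢ d ⊕ c ⇒ v → d ≉ b → Walk d c w b →
              pathTree (replicate (length w) l ++ xs) ⊢ d ⊕ b ⇒ v ++ w
leftSpine-⇒ {d} {c} {b = b} xs d≉c D d≉b (edge c≉b) =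
  node (⊕-rule d b c d≉b d≉c c≉b) D leaf
leftSpine-⇒ {d} {c} {v} xs d≉c D d≉b (step {c = e} {w = w} c≉e e≉d p) =
  cast (leftSpine-⇒ (l ∷ xs) (≉-sym e≉d)
         (node (⊕-rule d e c (≉-sym e≉d) d≉c c≉e) D leaf) d≉b p)
  where
  cast = λ D′ → subst (λ ys → pathTree ys ⊢ _ ⇒ _) (replicate-shift (length w) l xs)
    (subst (_ ⊢ _ ⇒_) (++-assoc v [ c ⊕ e ] w) D′)

theorem13 : (n : ℕ) → 4 ≤ n → (T₁ T₂ : BinaryTree) →
    #leaves T₁ ≡ n → IsLeftTurnTree n T₂ →
    ∃[ w ] (length w ≡ n × T₁ parses w × T₂ parses w)
-- For p = 0 the hub q is the last vertex n.
theorem13 n _ T₁ _ #T₁ (zero , suc (suc k) , s≤s (s≤s _) , refl , refl)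
  with w , D , p ← fan {a = 0F} {d = 3F} T₁ _ =
  w , len , ⇒-parses D , ⇒-parses (rightComb-⇒ k _ len p)
  where len = trans (length-⇒ D) #T₁
theorem13 n _ T₁ _ #T₁ (suc m , suc (suc k) , s≤s (s≤s _) , refl , refl)
  -- `gap` takes predecessors: q = 2 + k leaves lie left of the hub and p = 1 + m right of it.
  with b , b≉0 , v , w , #v , #w , D , p , q ← cut (gap T₁ (suc k) m
         (trans (+-comm (suc (suc k)) (suc m)) (sym #T₁))) =
  v ++ w , trans (length-⇒ D) #T₁ , ⇒-parses D ,
  subst (λ p → LeftTurnTree p (2 + k) parses v ++ w) #w
    (⇒-parses (leftSpine-⇒ (replicate k r) _ (rightComb-⇒ k _ #v p) (≉-sym b≉0) q))
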